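{- Let $\mathbb{P}=(R,G)$ be a partial field, let $M$ be a matroid on ground set $E$ with basis $B$, and let $M=M[I\;A]$ for some $B\times(E\setminus B)$ $\mathbb{P}$-matrix $A$ that is $T$-normalized for a maximal spanning forest $T$ of $G(A)$. Then there exists a ring homomorphism $\phi:\mathbb{B}_{M,B,T}\to R$ such that $\phi(\hat A_{M,B,T})=A$ (with $\phi$ applied entrywise).
   Context: A partial field is a pair $\mathbb{P}=(R,G)$ with $R$ a commutative ring with identity and $G$ a subgroup of $R^*$ with $-1\in G$; as a set $\mathbb{P}=G\cup\{0\}$. An $X\times Y$ matrix (rows labelled by $X$, columns by $Y$, finite disjoint sets) with entries in $\mathbb{P}$ is a $\mathbb{P}$-matrix if the determinant of every square submatrix lies in $\mathbb{P}$. $M[I\;A]$ is the matroid on $X\cup Y$ whose bases are the sets $Z$ with $|Z|=|X|$ and $\det(A[X\setminus Z,Y\cap Z])\ne 0$ (the empty determinant is $1$). $G(A)$ is the bipartite graph on $X\cup Y$ with edges $xy$ ($x\in X$, $y\in Y$) for which $A_{xy}\neq 0$. $A$ is $T$-normalized, for a maximal spanning forest $T$ of $G(A)$, if $A_{xy}=1$ for all $xy\in T$. Let $M=(E,\mathcal{B})$ be a matroid of rank $r$ with set of bases $\mathcal{B}$, let $B\in\mathcal{B}$, and let $G(M,B)$ be the bipartite graph on $B\cup(E\setminus B)$ with edges $xy$ ($x\in B$, $y\in E\setminus B$) for which $(B\setminus x)\cup y\in\mathcal{B}$ (if $M=M[I\;A]$ with $A$ a $B\times(E\setminus B)$ matrix,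 then $G(M,B)=G(A)$). Let $T$ be a maximal spanning forest of $G(M,B)$. Introduce indeterminates $a_{xy}$ ($x\in B$, $y\in E\setminus B$) and $i_{B'}$ ($B'\in\mathcal{B}$), collected in the set $\mathcal{Y}_M$, and let $\hat A_{M,B}$ be the $B\times(E\setminus B)$ matrix with entries $a_{xy}$. Let $I_{M,B,T}$ be the ideal of $\mathbb{Z}[\mathcal{Y}_M]$ generated by, for all $Z\subseteq E$ with $|Z|=r$: $\det(\hat A_{M,B}[B\setminus Z,(E\setminus B)\cap Z])$ if $Z\notin\mathcal{B}$; $\det(\hat A_{M,B}[B\setminus Z,(E\setminus B)\cap Z])\,i_Z-1$ if $Z\in\mathcal{B}$; together with $a_{xy}-1$ for all $xy\in T$. Then $\mathbb{B}_{M,B,T}:=\mathbb{Z}[\mathcal{Y}_M]/I_{M,B,T}$, and $\hat A_{M,B,T}$ is the matrix $\hat A_{M,B}$ viewed over $\mathbb{B}_{M,B,T}$. -}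

module Defs where

open import Algebra.Bundles using (AbelianGroup; CommutativeRing; RawRing)
import Algebra.Definitions.RawMonoid as RawMonoidDefs
import Algebra.Definitions.RawSemiring as RawSemiringDefs
import Algebra.Properties.AbelianGroup as AbelianGroupProperties
import Algebra.Properties.Ring as RingProperties
open import Algebra.Structures using (IsCommutativeRing)
open import Data.Bool.Base using (if_then_else_)
open import Data.Fin.Base using (Fin; zero; suc; cast; fromℕ; inject₁; punchIn; toℕ)
import Data.Fin.Properties as Fin
open import Data.Fin.Subset
  using (Subset; inside; outside; _∈_; _∉_; _⊆_; _∪_; _∩_; _─_; ∁; ⁅_⁆; ∣_∣)
  renaming (_-_ to _∖_)
open import Data.Fin.Subset.Properties using (p─q⊆p; p∩q⊆p)
import Data.Bool.Properties as Bool
open import Data.Integer.Base as ℤ using (ℤ; 0ℤ; 1ℤ)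
import Data.Integer.Properties as ℤ
open import Data.Irrelevant using ([_])
open import Data.List.Base as List using (List; []; _∷_; _++_; cartesianProductWith; length)
open import Data.List.Relation.Binary.Permutation.Propositional
  using (_↭_; ↭-refl; ↭-sym; ↭-trans; prep)
open import Data.List.Relation.Binary.Permutation.Propositional.Properties
  using (++⁺; ++⁺ʳ; ++-comm; ++-assoc; ∈-resp-↭; drop-mid; shift; ↭-length)
open import Data.List.Relation.Unary.Any using (here)
import Data.List.Membership.DecPropositional as DecMembership
open import Data.List.Membership.Propositional.Properties using (∈-∃++)
open import Data.Nat.Base as ℕ using (ℕ; zero; suc)
import Data.Nat.Properties as ℕ
open import Data.Product.Base using (∃; Σ; _×_; _,_)
open import Data.Refinement as Refinement using (Refinement-syntax; value; _,_)
open import Data.Sum.Base using (_⊎_)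
open import Data.Vec.Base using ([]; _∷_; here; there)
import Data.Vec.Properties as Vec
open import Function.Base using (_∘_)
open import Function.Bundles using (_⇔_)
open import Function.Definitions using (Injective)
open import Level using (Level; _⊔_; 0ℓ) renaming (suc to lsuc)
open import Relation.Binary.Core using (REL; _⇒_)
open import Relation.Binary.Definitions using (DecidableEquality)
open import Relation.Binary.PropositionalEquality
  using (_≡_; refl; sym; trans; cong; cong₂; module ≡-Reasoning)
open import Relation.Nullary using (¬_; Dec; yes; no; does; contradiction)
open import Relation.Nullary.Decidable using (map′; _×-dec_; dec-true; dec-false)
open import Relation.Unary using (Pred; Decidable)

private
  variable
    c ℓ g s t u : Level
    n : ℕ

------------------------------------------------------------------------
-- Labelled matrices and their minors

Elem : Subset n → Set
Elem {n} P = [ x ∈ Fin n ∣ x ∈ P ]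

-- The elements of P in increasing order.
enum : (P : Subset n) → Fin ∣ P ∣ → Elem P
enum (inside  ∷ P) zero    = zero , [ here ]
enum (inside  ∷ P) (suc i) = Refinement.map suc there (enum P i)
enum (outside ∷ P) i       = Refinement.map suc there (enum P i)

module _ (K : RawRing c ℓ) where

  open RawRing K
  open RawMonoidDefs +-rawMonoid using (sum)
  open RawSemiringDefs rawSemiring using (_^_)

  Matrix : Subset n → Subset n → Set c
  Matrix X Y = Elem X → Elem Y → Carrier

  -- Laplace expansion along the first row.
  det : ∀ {k} → (Fin k → Fin k → Carrier) → Carrier
  det {zero}  A = 1#
  det {suc k} A = sum λ j →
    ((- 1#) ^ toℕ j) * (A zero j * det λ i l → A (suc i) (punchIn j l))

-- The determinant of the submatrix A[P,Q].  The labels carry the order of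
-- Fin n, which fixes the sign.
minor : (K : RawRing c ℓ) {X Y : Subset n} → Matrix K X Y →
        (P Q : Subset n) → P ⊆ X → Q ⊆ Y → ∣ P ∣ ≡ ∣ Q ∣ → RawRing.Carrier K
minor K A P Q P⊆X Q⊆Y ∣P∣≡∣Q∣ = det K λ i j →
  A (Refinement.refine P⊆X (enum P i))
    (Refinement.refine Q⊆Y (enum Q (cast ∣P∣≡∣Q∣ j)))

private
  ∣∣-split : (X Z : Subset n) → ∣ X ∣ ≡ ∣ X ∩ Z ∣ ℕ.+ ∣ X ─ Z ∣
  ∣∣-split []            []            = refl
  ∣∣-split (inside  ∷ X) (inside  ∷ Z) = cong suc (∣∣-split X Z)
  ∣∣-split (inside  ∷ X) (outside ∷ Z) =
    trans (cong suc (∣∣-split X Z)) (sym (ℕ.+-suc _ _))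
  ∣∣-split (outside ∷ X) (inside  ∷ Z) = ∣∣-split X Z
  ∣∣-split (outside ∷ X) (outside ∷ Z) = ∣∣-split X Z

  ∣∣-split′ : (X Z : Subset n) → ∣ Z ∣ ≡ ∣ X ∩ Z ∣ ℕ.+ ∣ ∁ X ∩ Z ∣
  ∣∣-split′ []            []            = refl
  ∣∣-split′ (inside  ∷ X) (inside  ∷ Z) = cong suc (∣∣-split′ X Z)
  ∣∣-split′ (inside  ∷ X) (outside ∷ Z) = ∣∣-split′ X Z
  ∣∣-split′ (outside ∷ X) (inside  ∷ Z) =
    trans (cong suc (∣∣-split′ X Z)) (sym (ℕ.+-suc _ _))
  ∣∣-split′ (outside ∷ X) (outside ∷ Z) = ∣∣-split′ X Z

∣X─Z∣≡∣∁X∩Z∣ : (X Z : Subset n) → ∣ Z ∣ ≡ ∣ X ∣ → ∣ X ─ Z ∣ ≡ ∣ ∁ X ∩ Z ∣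
∣X─Z∣≡∣∁X∩Z∣ X Z eq = ℕ.+-cancelˡ-≡ ∣ X ∩ Z ∣ _ _
  (trans (sym (∣∣-split X Z)) (trans (sym eq) (∣∣-split′ X Z)))

-- det (A[X∖Z, Y∩Z]) for an X × Y matrix A, where Y is the complement of X.
basisMinor : (K : RawRing c ℓ) {X : Subset n} → Matrix K X (∁ X) →
             (Z : Subset n) → ∣ Z ∣ ≡ ∣ X ∣ → RawRing.Carrier K
basisMinor K {X} A Z eq =
  minor K A (X ─ Z) (∁ X ∩ Z) (p─q⊆p X Z) (p∩q⊆p (∁ X) Z) (∣X─Z∣≡∣∁X∩Z∣ X Z eq)

------------------------------------------------------------------------
-- Partial fields

record PartialField c ℓ g : Set (lsuc (c ⊔ ℓ ⊔ g)) where
  field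
    commutativeRing : CommutativeRing c ℓ

  open CommutativeRing commutativeRing public

  -- G is a subgroup of the group of units; that its elements are units is
  -- part of the field inverse.
  field
    G         : Pred Carrier g
    G-resp-≈  : ∀ {x y} → x ≈ y → G x → G y
    1∈G       : G 1#
    *-closed  : ∀ {x y} → G x → G y → G (x * y)
    inverse   : ∀ {x} → G x → ∃ λ y → G y × x * y ≈ 1#
    -1∈G      : G (- 1#)

  Element : Pred Carrier (ℓ ⊔ g)
  Element x = G x ⊎ x ≈ 0#

module _ (ℙ : PartialField c ℓ g) where

  open PartialField ℙ

  record IsPMatrix {X Y : Subset n} (A : Matrix rawRing X Y) : Set (ℓ ⊔ g) where
    field
      entries : ∀ x y → Element (A x y)
      minors  : ∀ P Q (P⊆X : P ⊆ X) (Q⊆Y : Q ⊆ Y) (eq : ∣ P ∣ ≡ ∣ Q ∣) →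
                Element (minor rawRing A P Q P⊆X Q⊆Y eq)

------------------------------------------------------------------------
-- Matroids

record Matroid (n : ℕ) : Set₁ where
  field
    Basis    : Pred (Subset n) 0ℓ
    Basis?   : Decidable Basis
    nonempty : ∃ Basis
    exchange : ∀ {B₁ B₂} → Basis B₁ → Basis B₂ →
               ∀ {x} → x ∈ B₁ → x ∉ B₂ →
               ∃ λ y → y ∈ B₂ × y ∉ B₁ × Basis ((B₁ ∖ x) ∪ ⁅ y ⁆)

module _ (K : RawRing c ℓ) where

  open RawRing K

  -- The bases of M[I A].
  Basis[I_] : {X : Subset n} → Matrix K X (∁ X) → Pred (Subset n) ℓ
  Basis[I_] {X = X} A Z =
    Σ (∣ Z ∣ ≡ ∣ X ∣) λ eq → ¬ (basisMinor K A Z eq ≈ 0#)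

  _≐M[I_] : Matroid n → {X : Subset n} → Matrix K X (∁ X) → Set ℓ
  M ≐M[I A ] = ∀ Z → Matroid.Basis M Z ⇔ Basis[I_] A Z

------------------------------------------------------------------------
-- Bipartite graphs

-- A bipartite graph on X ∪ Y, given by its edges xy with x ∈ X and y ∈ Y.
-- Since all vertices are always present, every set of edges is spanning.
BipartiteGraph : Subset n → Subset n → (t : Level) → Set (lsuc t)
BipartiteGraph X Y t = REL (Elem X) (Elem Y) t

supportGraph : (K : RawRing c ℓ) {X Y : Subset n} → Matrix K X Y → BipartiteGraph X Y ℓ
supportGraph K A x y = ¬ (A x y ≈ 0#)
  where open RawRing K

cyclicPred : ∀ {k} → Fin (suc k) → Fin (suc k)
cyclicPred zero    = fromℕ _
cyclicPred (suc i) = inject₁ i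

-- A cycle x₀ y₀ x₁ y₁ ⋯ xₘ yₘ x₀ with m ≥ 1; in a bipartite graph every
-- cycle alternates in this way.
record Cycle {X Y : Subset n} (E : BipartiteGraph X Y t) : Set t where
  field
    {k}   : ℕ
    x     : Fin (2 ℕ.+ k) → Elem X
    y     : Fin (2 ℕ.+ k) → Elem Y
    x-inj : Injective _≡_ _≡_ x
    y-inj : Injective _≡_ _≡_ y
    edge  : ∀ i → E (x i) (y i)
    edge′ : ∀ i → E (x i) (y (cyclicPred i))

record IsMaximalSpanningForest {X Y : Subset n} (E : BipartiteGraph X Y s)
                               (T : BipartiteGraph X Y t) : Set (s ⊔ lsuc t) where
  field
    subgraph : T ⇒ E
    acyclic  : ¬ Cycle T
    maximal  : ∀ (T′ : BipartiteGraph X Y t) → T′ ⇒ E → ¬ Cycle T′ → T ⇒ T′ → T′ ⇒ T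

Normalized : (K : RawRing c ℓ) {X Y : Subset n} →
             Matrix K X Y → BipartiteGraph X Y t → Set (ℓ ⊔ t)
Normalized K A T = ∀ {x y} → T x y → A x y ≈ 1#
  where open RawRing K

------------------------------------------------------------------------
-- Quotients by ideals

module Quotient (R : CommutativeRing c ℓ) (S : Pred (CommutativeRing.Carrier R) s) where

  open CommutativeRing R
    renaming (refl to ≈-refl; sym to ≈-sym; trans to ≈-trans)
  open RingProperties ring using (-1*x≈-x; x[y-z]≈xy-xz; -‿+-comm; ⁻¹-anti-homo-//)

  data Ideal : Pred Carrier (c ⊔ ℓ ⊔ s) where
    generator : ∀ {x} → S x → Ideal x
    0∈        : Ideal 0#
    +∈        : ∀ {x y} → Ideal x → Ideal y → Ideal (x + y)
    *∈        : ∀ r {x} → Ideal x → Ideal (r * x)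
    resp      : ∀ {x y} → x ≈ y → Ideal x → Ideal y

  infix 4 _≈ᵢ_
  record _≈ᵢ_ (x y : Carrier) : Set (c ⊔ ℓ ⊔ s) where
    constructor mk
    field difference : Ideal (x - y)

  private
    open import Relation.Binary.Reasoning.Setoid setoid

    neg∈ : ∀ {x} → Ideal x → Ideal (- x)
    neg∈ p = resp (-1*x≈-x _) (*∈ (- 1#) p)

    lift : ∀ {x y} → x ≈ y → x ≈ᵢ y
    lift x≈y = mk (resp (≈-sym (≈-trans (+-congʳ x≈y) (-‿inverseʳ _))) 0∈)

    symᵢ : ∀ {x y} → x ≈ᵢ y → y ≈ᵢ x
    symᵢ (mk p) = mk (resp (⁻¹-anti-homo-// _ _) (neg∈ p))

    transᵢ : ∀ {x y z} → x ≈ᵢ y → y ≈ᵢ z → x ≈ᵢ z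
    transᵢ {x} {y} {z} (mk p) (mk q) = mk (resp eq (+∈ p q))
      where
      eq = begin
        (x - y) + (y - z)     ≈⟨ +-assoc x (- y) (y - z) ⟩
        x + (- y + (y - z))   ≈⟨ +-congˡ (+-assoc (- y) y (- z)) ⟨
        x + ((- y + y) - z)   ≈⟨ +-congˡ (+-congʳ (-‿inverseˡ y)) ⟩
        x + (0# - z)          ≈⟨ +-congˡ (+-identityˡ (- z)) ⟩
        x - z                 ∎

    +-congᵢ : ∀ {x x′ y y′} → x ≈ᵢ x′ → y ≈ᵢ y′ → x + y ≈ᵢ x′ + y′
    +-congᵢ {x} {x′} {y} {y′} (mk p) (mk q) = mk (resp eq (+∈ p q))
      where
      eq = begin
        (x - x′) + (y - y′)       ≈⟨ +-assoc x (- x′) (y - y′) ⟩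
        x + (- x′ + (y - y′))     ≈⟨ +-congˡ (+-assoc (- x′) y (- y′)) ⟨
        x + ((- x′ + y) - y′)     ≈⟨ +-congˡ (+-congʳ (+-comm (- x′) y)) ⟩
        x + ((y - x′) - y′)       ≈⟨ +-congˡ (+-assoc y (- x′) (- y′)) ⟩
        x + (y + (- x′ - y′))     ≈⟨ +-assoc x y (- x′ - y′) ⟨
        (x + y) + (- x′ - y′)     ≈⟨ +-congˡ (-‿+-comm x′ y′) ⟩
        (x + y) - (x′ + y′)       ∎

    *-congˡᵢ : ∀ z {x y} → x ≈ᵢ y → z * x ≈ᵢ z * y
    *-congˡᵢ z {x} {y} (mk p) = mk (resp (x[y-z]≈xy-xz z x y) (*∈ z p))

    *-congᵢ : ∀ {x x′ y y′} → x ≈ᵢ x′ → y ≈ᵢ y′ → x * y ≈ᵢ x′ * y′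
    *-congᵢ {x} {x′} {y} {y′} p q = transᵢ (*-congˡᵢ x q)
      (transᵢ (lift (*-comm x y′)) (transᵢ (*-congˡᵢ y′ p) (lift (*-comm y′ x′))))

    -‿congᵢ : ∀ {x y} → x ≈ᵢ y → - x ≈ᵢ - y
    -‿congᵢ {x} {y} (mk p) = mk (resp (≈-sym (-‿+-comm x (- y))) (neg∈ p))

  isCommutativeRingᵢ : IsCommutativeRing _≈ᵢ_ _+_ _*_ -_ 0# 1#
  isCommutativeRingᵢ = record
    { isRing = record
      { +-isAbelianGroup = record
        { isGroup = record
          { isMonoid = record
            { isSemigroup = record
              { isMagma = record
                { isEquivalence = record
                  { refl = lift ≈-refl ; sym = symᵢ ; trans = transᵢ }
                ; ∙-cong = +-congᵢ }
              ; assoc = λ x y z → lift (+-assoc x y z) }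
            ; identity = (λ x → lift (+-identityˡ x)) , (λ x → lift (+-identityʳ x)) }
          ; inverse = (λ x → lift (-‿inverseˡ x)) , (λ x → lift (-‿inverseʳ x))
          ; ⁻¹-cong = -‿congᵢ }
        ; comm = λ x y → lift (+-comm x y) }
      ; *-cong = *-congᵢ
      ; *-assoc = λ x y z → lift (*-assoc x y z)
      ; *-identity = (λ x → lift (*-identityˡ x)) , (λ x → lift (*-identityʳ x))
      ; distrib = (λ x y z → lift (distribˡ x y z)) , (λ x y z → lift (distribʳ x y z))
      }
    ; *-comm = λ x y → lift (*-comm x y)
    }

  quotientRing : CommutativeRing c (c ⊔ ℓ ⊔ s)
  quotientRing = record { isCommutativeRing = isCommutativeRingᵢ }

------------------------------------------------------------------------
-- The polynomial ring ℤ[V]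

-- A polynomial is a formal sum of terms; a monomial is a multiset of
-- indeterminates.  Two polynomials are equal when all coefficients agree.

module Polynomials {V : Set} (_≟_ : DecidableEquality V) where

  Monomial : Set
  Monomial = List V

  infix 4 _↭?_
  _↭?_ : (m m′ : Monomial) → Dec (m ↭ m′)
  []      ↭? []       = yes ↭-refl
  []      ↭? (v ∷ m′) = no λ p → contradiction (↭-length p) λ ()
  (v ∷ m) ↭? m′ with DecMembership._∈?_ _≟_ v m′
  ... | no  v∉m′ = no λ p → v∉m′ (∈-resp-↭ p (here refl))
  ... | yes v∈m′ with ∈-∃++ v∈m′
  ...   | xs , ys , refl = map′
    (λ p → ↭-trans (prep v p) (↭-sym (shift v xs ys)))
    (drop-mid [] xs)
    (m ↭? xs ++ ys)

  Polynomial : Set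
  Polynomial = List (ℤ × Monomial)

  term : Monomial → ℤ → Monomial → ℤ
  term m c m′ = if does (m′ ↭? m) then c else 0ℤ

  coeff : Polynomial → Monomial → ℤ
  coeff p m = List.foldr (λ (c , m′) s → term m c m′ ℤ.+ s) 0ℤ p

  infix 4 _≈_
  record _≈_ (p q : Polynomial) : Set where
    constructor mk
    field coeff-≡ : ∀ m → coeff p m ≡ coeff q m

  open _≈_ public

  infixl 6 _+_
  infixl 7 _*_
  infix  8 -_

  _+_ _*_ : Polynomial → Polynomial → Polynomial
  _+_ = _++_
  _*_ = cartesianProductWith λ (c , m) (d , m′) → c ℤ.* d , m ++ m′

  -_ : Polynomial → Polynomial
  -_ = List.map λ (c , m) → ℤ.- c , m

  0# 1# : Polynomial
  0# = []
  1# = (1ℤ , []) ∷ []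

  var : V → Polynomial
  var v = (1ℤ , v ∷ []) ∷ []

  -- Extension of a map on terms to formal sums.
  module Extend (A : AbelianGroup u ℓ) where

    open AbelianGroup A using (Carrier; _∙_; ε; _⁻¹; setoid; ∙-cong; ∙-congˡ; ∙-congʳ)
      renaming (_≈_ to _∼_; refl to ∼-refl; sym to ∼-sym; trans to ∼-trans)
    private module A = AbelianGroup A
    open AbelianGroupProperties A using (∙-cancelˡ; ε⁻¹≈ε; inverseˡ-unique; ⁻¹-∙-comm; ⁻¹-involutive)
    open import Relation.Binary.Reasoning.Setoid setoid

    TermMap : Set u
    TermMap = ℤ → Monomial → Carrier

    record IsAdditive (f : TermMap) : Set (u ⊔ ℓ) where
      field
        resp-↭ : ∀ c {m m′} → m ↭ m′ → f c m ∼ f c m′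
        homo-+ : ∀ c d m → f (c ℤ.+ d) m ∼ f c m ∙ f d m

      homo-0 : ∀ m → f 0ℤ m ∼ ε
      homo-0 m = ∙-cancelˡ (f 0ℤ m) _ _
        (∼-trans (∼-sym (homo-+ 0ℤ 0ℤ m)) (∼-sym (A.identityʳ _)))

      homo-neg : ∀ c m → f (ℤ.- c) m ∼ f c m ⁻¹
      homo-neg c m = inverseˡ-unique _ _ (begin
        f (ℤ.- c) m ∙ f c m    ≈⟨ homo-+ (ℤ.- c) c m ⟨
        f (ℤ.- c ℤ.+ c) m      ≡⟨ cong (λ d → f d m) (ℤ.+-inverseˡ c) ⟩
        f 0ℤ m                 ≈⟨ homo-0 m ⟩
        ε                      ∎)

    extend : TermMap → Polynomial → Carrier
    extend f = List.foldr (λ (c , m) → f c m ∙_) ε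

    extend-≗ : ∀ {f h} → (∀ c m → f c m ∼ h c m) → ∀ p → extend f p ∼ extend h p
    extend-≗ f∼h []            = ∼-refl
    extend-≗ f∼h ((c , m) ∷ p) = ∙-cong (f∼h c m) (extend-≗ f∼h p)

    extend-++ : ∀ f p q → extend f (p ++ q) ∼ extend f p ∙ extend f q
    extend-++ f []            q = ∼-sym (A.identityˡ _)
    extend-++ f ((c , m) ∷ p) q = ∼-trans (∙-congˡ (extend-++ f p q)) (∼-sym (A.assoc _ _ _))

    extend-ε : ∀ p → extend (λ _ _ → ε) p ∼ ε
    extend-ε []      = ∼-refl
    extend-ε (_ ∷ p) = ∼-trans (A.identityˡ _) (extend-ε p)

    private
      interchange : ∀ w x y z → (w ∙ x) ∙ (y ∙ z) ∼ (w ∙ y) ∙ (x ∙ z)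
      interchange w x y z = begin
        (w ∙ x) ∙ (y ∙ z)   ≈⟨ A.assoc w x (y ∙ z) ⟩
        w ∙ (x ∙ (y ∙ z))   ≈⟨ ∙-congˡ (A.assoc x y z) ⟨
        w ∙ ((x ∙ y) ∙ z)   ≈⟨ ∙-congˡ (∙-congʳ (A.comm x y)) ⟩
        w ∙ ((y ∙ x) ∙ z)   ≈⟨ ∙-congˡ (A.assoc y x z) ⟩
        w ∙ (y ∙ (x ∙ z))   ≈⟨ A.assoc w y (x ∙ z) ⟨
        (w ∙ y) ∙ (x ∙ z)   ∎

    extend-∙ : ∀ f h p → extend (λ c m → f c m ∙ h c m) p ∼ extend f p ∙ extend h p
    extend-∙ f h []            = ∼-sym (A.identityˡ _)
    extend-∙ f h ((c , m) ∷ p) = ∼-trans (∙-congˡ (extend-∙ f h p)) (interchange _ _ _ _)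

    extend-swap : ∀ (f : ℤ → Monomial → TermMap) p q →
      extend (λ c m → extend (f c m) q) p ∼ extend (λ d m′ → extend (λ c m → f c m d m′) p) q
    extend-swap f []            q = ∼-sym (extend-ε q)
    extend-swap f ((c , m) ∷ p) q =
      ∼-trans (∙-congˡ (extend-swap f p q)) (∼-sym (extend-∙ (f c m) _ q))

    extend-* : ∀ f p q → extend f (p * q) ∼
      extend (λ c m → extend (λ d m′ → f (c ℤ.* d) (m ++ m′)) q) p
    extend-* f []            q = ∼-refl
    extend-* f ((c , m) ∷ p) q = ∼-trans
      (extend-++ f (List.map _ q) (p * q)) (∙-cong (extend-map q) (extend-* f p q))
      where
      extend-map : ∀ q → extend f (List.map (λ (d , m′) → c ℤ.* d , m ++ m′) q) ∼
                         extend (λ d m′ → f (c ℤ.* d) (m ++ m′)) q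
      extend-map []      = ∼-refl
      extend-map (_ ∷ q) = ∙-congˡ (extend-map q)

    module _ {f : TermMap} (f-additive : IsAdditive f) where

      open IsAdditive f-additive

      extend-neg : ∀ p → extend f (- p) ∼ extend f p ⁻¹
      extend-neg []            = ∼-sym ε⁻¹≈ε
      extend-neg ((c , m) ∷ p) =
        ∼-trans (∙-cong (homo-neg c m) (extend-neg p)) (⁻¹-∙-comm _ _)

      private
        remove : Monomial → Polynomial → Polynomial
        remove m [] = []
        remove m ((c , m′) ∷ p) = if does (m′ ↭? m) then remove m p else (c , m′) ∷ remove m p

        length-remove : ∀ m p → length (remove m p) ℕ.≤ length p
        length-remove m [] = ℕ.z≤n
        length-remove m ((c , m′) ∷ p) with m′ ↭? m
        ... | yes _ = ℕ.m≤n⇒m≤1+n (length-remove m p)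
        ... | no  _ = ℕ.s≤s (length-remove m p)

        extend-remove : ∀ m p → extend f p ∼ f (coeff p m) m ∙ extend f (remove m p)
        extend-remove m [] = ∼-sym (∼-trans (A.identityʳ _) (homo-0 m))
        extend-remove m ((c , m′) ∷ p) with m′ ↭? m
        ... | yes m′↭m = begin
          f c m′ ∙ extend f p
            ≈⟨ ∙-cong (resp-↭ c m′↭m) (extend-remove m p) ⟩
          f c m ∙ (f (coeff p m) m ∙ extend f (remove m p))
            ≈⟨ A.assoc _ _ _ ⟨
          (f c m ∙ f (coeff p m) m) ∙ extend f (remove m p)
            ≈⟨ ∙-congʳ (homo-+ c (coeff p m) m) ⟨
          f (c ℤ.+ coeff p m) m ∙ extend f (remove m p) ∎
        ... | no _ = begin
          f c m′ ∙ extend f p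
            ≈⟨ ∙-congˡ (extend-remove m p) ⟩
          f c m′ ∙ (f (coeff p m) m ∙ extend f (remove m p))
            ≈⟨ A.assoc _ _ _ ⟨
          (f c m′ ∙ f (coeff p m) m) ∙ extend f (remove m p)
            ≈⟨ ∙-congʳ (A.comm _ _) ⟩
          (f (coeff p m) m ∙ f c m′) ∙ extend f (remove m p)
            ≈⟨ A.assoc _ _ _ ⟩
          f (coeff p m) m ∙ (f c m′ ∙ extend f (remove m p))
            ≡⟨ cong (λ d → f d m ∙ (f c m′ ∙ extend f (remove m p))) (ℤ.+-identityˡ (coeff p m)) ⟨
          f (0ℤ ℤ.+ coeff p m) m ∙ (f c m′ ∙ extend f (remove m p)) ∎

        coeff-remove-↭ : ∀ {m m₁} → m ↭ m₁ → ∀ p → coeff (remove m p) m₁ ≡ 0ℤ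
        coeff-remove-↭ m↭m₁ [] = refl
        coeff-remove-↭ {m} {m₁} m↭m₁ ((c , m′) ∷ p) with m′ ↭? m
        ... | yes _ = coeff-remove-↭ m↭m₁ p
        ... | no ¬m′↭m rewrite dec-false (m′ ↭? m₁) (λ q → ¬m′↭m (↭-trans q (↭-sym m↭m₁))) =
          trans (ℤ.+-identityˡ _) (coeff-remove-↭ m↭m₁ p)

        coeff-remove-¬↭ : ∀ {m m₁} → ¬ (m ↭ m₁) → ∀ p → coeff (remove m p) m₁ ≡ coeff p m₁
        coeff-remove-¬↭ ¬m↭m₁ [] = refl
        coeff-remove-¬↭ {m} {m₁} ¬m↭m₁ ((c , m′) ∷ p) with m′ ↭? m
        ... | no _ = cong (λ d → term m₁ c m′ ℤ.+ d) (coeff-remove-¬↭ ¬m↭m₁ p)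
        ... | yes m′↭m rewrite dec-false (m′ ↭? m₁) (λ q → ¬m↭m₁ (↭-trans (↭-sym m′↭m) q)) =
          trans (coeff-remove-¬↭ ¬m↭m₁ p) (sym (ℤ.+-identityˡ _))

        extend-zero : ∀ k p → length p ℕ.≤ k → (∀ m → coeff p m ≡ 0ℤ) → extend f p ∼ ε
        extend-zero k       []            _          _   = ∼-refl
        extend-zero (suc k) ((c , m) ∷ p) (ℕ.s≤s ≤k) p≈0 = begin
          extend f p⁺
            ≈⟨ extend-remove m p⁺ ⟩
          f (coeff p⁺ m) m ∙ extend f (remove m p⁺)
            ≡⟨ cong₂ (λ d q → f d m ∙ extend f q) (p≈0 m) remove-head ⟩
          f 0ℤ m ∙ extend f (remove m p)
            ≈⟨ ∙-cong (homo-0 m)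
                 (extend-zero k (remove m p) (ℕ.≤-trans (length-remove m p) ≤k) rest≈0) ⟩
          ε ∙ ε
            ≈⟨ A.identityˡ ε ⟩
          ε ∎
          where
          p⁺ = (c , m) ∷ p

          remove-head : remove m p⁺ ≡ remove m p
          remove-head = cong (λ b → if b then remove m p else (c , m) ∷ remove m p)
            (dec-true (m ↭? m) ↭-refl)

          rest≈0 : ∀ m₁ → coeff (remove m p) m₁ ≡ 0ℤ
          rest≈0 m₁ with m ↭? m₁
          ... | yes m↭m₁ = coeff-remove-↭ m↭m₁ p
          ... | no ¬m↭m₁ = trans (cong (λ q → coeff q m₁) (sym remove-head))
            (trans (coeff-remove-¬↭ ¬m↭m₁ p⁺) (p≈0 m₁))

      coeff≡0⇒extend∼ε : ∀ p → (∀ m → coeff p m ≡ 0ℤ) → extend f p ∼ ε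
      coeff≡0⇒extend∼ε p = extend-zero (length p) p ℕ.≤-refl

  private
    module E = Extend ℤ.+-0-abelianGroup

    term-additive : ∀ m → E.IsAdditive (term m)
    term-additive m = record { resp-↭ = resp ; homo-+ = homo }
      where
      resp : ∀ c {m₁ m₂} → m₁ ↭ m₂ → term m c m₁ ≡ term m c m₂
      resp c {m₁} {m₂} p with m₁ ↭? m
      ... | yes q rewrite dec-true  (m₂ ↭? m) (↭-trans (↭-sym p) q) = refl
      ... | no ¬q rewrite dec-false (m₂ ↭? m) (¬q ∘ ↭-trans p)      = refl

      homo : ∀ c d m′ → term m (c ℤ.+ d) m′ ≡ term m c m′ ℤ.+ term m d m′
      homo c d m′ with m′ ↭? m
      ... | yes _ = refl
      ... | no  _ = refl

  module _ (A : AbelianGroup u ℓ) where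

    open Extend A
    open AbelianGroup A using (∙-congˡ) renaming (trans to ∼-trans; sym to ∼-sym; _≈_ to _∼_)
    open AbelianGroupProperties A using (x∙y⁻¹≈ε⇒x≈y)

    extend-cong : ∀ {f} → IsAdditive f → ∀ {p q} → p ≈ q → extend f p ∼ extend f q
    extend-cong {f} f-additive {p} {q} p≈q = x∙y⁻¹≈ε⇒x≈y _ _
      (∼-trans (∙-congˡ (∼-sym (extend-neg f-additive q)))
      (∼-trans (∼-sym (extend-++ f p (- q)))
      (coeff≡0⇒extend∼ε f-additive (p + - q) λ m → begin
        coeff (p + - q) m              ≡⟨ E.extend-++ (term m) p (- q) ⟩
        coeff p m ℤ.+ coeff (- q) m    ≡⟨ cong₂ ℤ._+_ (coeff-≡ p≈q m) (E.extend-neg (term-additive m) q) ⟩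
        coeff q m ℤ.+ ℤ.- coeff q m    ≡⟨ ℤ.+-inverseʳ (coeff q m) ⟩
        0ℤ                             ∎)))
      where open ≡-Reasoning

  private
    open ≡-Reasoning

    coeff-+ : ∀ p q m → coeff (p + q) m ≡ coeff p m ℤ.+ coeff q m
    coeff-+ p q m = E.extend-++ (term m) p q

    coeff-neg : ∀ p m → coeff (- p) m ≡ ℤ.- coeff p m
    coeff-neg p m = E.extend-neg (term-additive m) p

    ≈-refl : ∀ {p} → p ≈ p
    ≈-refl = mk λ _ → refl

    ≈-sym : ∀ {p q} → p ≈ q → q ≈ p
    ≈-sym p≈q = mk λ m → sym (coeff-≡ p≈q m)

    ≈-trans : ∀ {p q r} → p ≈ q → q ≈ r → p ≈ r
    ≈-trans p≈q q≈r = mk λ m → trans (coeff-≡ p≈q m) (coeff-≡ q≈r m)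

    +-cong : ∀ {p p′ q q′} → p ≈ p′ → q ≈ q′ → p + q ≈ p′ + q′
    +-cong {p} {p′} {q} {q′} e e′ = mk λ m → trans (coeff-+ p q m)
      (trans (cong₂ ℤ._+_ (coeff-≡ e m) (coeff-≡ e′ m)) (sym (coeff-+ p′ q′ m)))

    +-assoc : ∀ p q r → (p + q) + r ≈ p + (q + r)
    +-assoc p q r = mk λ m → begin
      coeff ((p + q) + r) m                        ≡⟨ coeff-+ (p + q) r m ⟩
      coeff (p + q) m ℤ.+ coeff r m                ≡⟨ cong (ℤ._+ coeff r m) (coeff-+ p q m) ⟩
      coeff p m ℤ.+ coeff q m ℤ.+ coeff r m        ≡⟨ ℤ.+-assoc (coeff p m) (coeff q m) (coeff r m) ⟩
      coeff p m ℤ.+ (coeff q m ℤ.+ coeff r m)      ≡⟨ cong (λ z → coeff p m ℤ.+ z) (coeff-+ q r m) ⟨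
      coeff p m ℤ.+ coeff (q + r) m                ≡⟨ coeff-+ p (q + r) m ⟨
      coeff (p + (q + r)) m                        ∎

    +-comm : ∀ p q → p + q ≈ q + p
    +-comm p q = mk λ m → trans (coeff-+ p q m)
      (trans (ℤ.+-comm (coeff p m) (coeff q m)) (sym (coeff-+ q p m)))

    +-identityˡ : ∀ p → 0# + p ≈ p
    +-identityˡ p = ≈-refl

    +-identityʳ : ∀ p → p + 0# ≈ p
    +-identityʳ p = +-comm p 0#

    -‿cong : ∀ {p q} → p ≈ q → - p ≈ - q
    -‿cong {p} {q} e = mk λ m → trans (coeff-neg p m)
      (trans (cong ℤ.-_ (coeff-≡ e m)) (sym (coeff-neg q m)))

    -‿inverseˡ : ∀ p → - p + p ≈ 0#
    -‿inverseˡ p = mk λ m → trans (coeff-+ (- p) p m)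
      (trans (cong (ℤ._+ coeff p m) (coeff-neg p m)) (ℤ.+-inverseˡ (coeff p m)))

    -‿inverseʳ : ∀ p → p + - p ≈ 0#
    -‿inverseʳ p = ≈-trans (+-comm p (- p)) (-‿inverseˡ p)

    coeff-*-term : Monomial → Polynomial → E.TermMap
    coeff-*-term m q c m₁ = E.extend (λ d m₂ → term m (c ℤ.* d) (m₁ ++ m₂)) q

    *-comm : ∀ p q → p * q ≈ q * p
    *-comm p q = mk λ m → begin
      coeff (p * q) m
        ≡⟨ E.extend-* (term m) p q ⟩
      E.extend (coeff-*-term m q) p
        ≡⟨ E.extend-swap (λ c m₁ d m₂ → term m (c ℤ.* d) (m₁ ++ m₂)) p q ⟩
      E.extend (λ d m₂ → E.extend (λ c m₁ → term m (c ℤ.* d) (m₁ ++ m₂)) p) q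
        ≡⟨ E.extend-≗ (λ d m₂ → E.extend-≗ (λ c m₁ → trans
             (E.IsAdditive.resp-↭ (term-additive m) (c ℤ.* d) (++-comm m₁ m₂))
             (cong (λ e → term m e (m₂ ++ m₁)) (ℤ.*-comm c d))) p) q ⟩
      E.extend (λ d m₂ → E.extend (λ c m₁ → term m (d ℤ.* c) (m₂ ++ m₁)) p) q
        ≡⟨ E.extend-* (term m) q p ⟨
      coeff (q * p) m ∎

    *-congʳ : ∀ {p p′} q → p ≈ p′ → p * q ≈ p′ * q
    *-congʳ {p} {p′} q e = mk λ m → trans (E.extend-* (term m) p q)
      (trans (extend-cong ℤ.+-0-abelianGroup (additive m) e) (sym (E.extend-* (term m) p′ q)))
      where
      additive : ∀ m → E.IsAdditive (coeff-*-term m q)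
      additive m = record
        { resp-↭ = λ c p → E.extend-≗
            (λ d m₂ → resp-↭ (c ℤ.* d) (++⁺ʳ m₂ p)) q
        ; homo-+ = λ c c′ m₁ → trans
            (E.extend-≗ (λ d m₂ → trans
              (cong (λ e → term m e (m₁ ++ m₂)) (ℤ.*-distribʳ-+ d c c′))
              (homo-+ (c ℤ.* d) (c′ ℤ.* d) (m₁ ++ m₂))) q)
            (E.extend-∙ (λ d m₂ → term m (c ℤ.* d) (m₁ ++ m₂))
                        (λ d m₂ → term m (c′ ℤ.* d) (m₁ ++ m₂)) q)
        }
        where open E.IsAdditive (term-additive m)

    *-cong : ∀ {p p′ q q′} → p ≈ p′ → q ≈ q′ → p * q ≈ p′ * q′
    *-cong {p} {p′} {q} {q′} e e′ = ≈-trans (*-congʳ q e)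
      (≈-trans (*-comm p′ q) (≈-trans (*-congʳ p′ e′) (*-comm q′ p′)))

    *-assoc : ∀ p q r → (p * q) * r ≈ p * (q * r)
    *-assoc p q r = mk λ m → begin
      coeff ((p * q) * r) m
        ≡⟨ E.extend-* (term m) (p * q) r ⟩
      E.extend (coeff-*-term m r) (p * q)
        ≡⟨ E.extend-* (coeff-*-term m r) p q ⟩
      E.extend (λ b m₀ → E.extend (λ c m₁ → E.extend
        (λ d m₂ → term m (b ℤ.* c ℤ.* d) ((m₀ ++ m₁) ++ m₂)) r) q) p
        ≡⟨ E.extend-≗ (λ b m₀ → trans
             (E.extend-≗ (λ c m₁ → E.extend-≗ (λ d m₂ → trans
               (E.IsAdditive.resp-↭ (term-additive m) (b ℤ.* c ℤ.* d) (++-assoc m₀ m₁ m₂))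
               (cong (λ e → term m e (m₀ ++ (m₁ ++ m₂))) (ℤ.*-assoc b c d))) r) q)
             (sym (E.extend-* (λ e m′ → term m (b ℤ.* e) (m₀ ++ m′)) q r))) p ⟩
      E.extend (λ b m₀ → E.extend (λ e m′ → term m (b ℤ.* e) (m₀ ++ m′)) (q * r)) p
        ≡⟨ E.extend-* (term m) p (q * r) ⟨
      coeff (p * (q * r)) m ∎

    *-identityˡ : ∀ p → 1# * p ≈ p
    *-identityˡ p = mk λ m → trans (E.extend-* (term m) 1# p) (trans (ℤ.+-identityʳ _)
      (E.extend-≗ (λ c m₁ → cong (λ d → term m d m₁) (ℤ.*-identityˡ c)) p))

    *-identityʳ : ∀ p → p * 1# ≈ p
    *-identityʳ p = ≈-trans (*-comm p 1#) (*-identityˡ p)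

    distribʳ : ∀ r p q → (p + q) * r ≈ p * r + q * r
    distribʳ r p q = mk λ m → begin
      coeff ((p + q) * r) m
        ≡⟨ E.extend-* (term m) (p + q) r ⟩
      E.extend (coeff-*-term m r) (p + q)
        ≡⟨ E.extend-++ (coeff-*-term m r) p q ⟩
      E.extend (coeff-*-term m r) p ℤ.+ E.extend (coeff-*-term m r) q
        ≡⟨ cong₂ ℤ._+_ (E.extend-* (term m) p r) (E.extend-* (term m) q r) ⟨
      coeff (p * r) m ℤ.+ coeff (q * r) m
        ≡⟨ coeff-+ (p * r) (q * r) m ⟨
      coeff (p * r + q * r) m ∎

    distribˡ : ∀ r p q → r * (p + q) ≈ r * p + r * q
    distribˡ r p q = ≈-trans (*-comm r (p + q))
      (≈-trans (distribʳ r p q) (+-cong (*-comm p r) (*-comm q r)))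

  +-*-isCommutativeRing : IsCommutativeRing _≈_ _+_ _*_ -_ 0# 1#
  +-*-isCommutativeRing = record
    { isRing = record
      { +-isAbelianGroup = record
        { isGroup = record
          { isMonoid = record
            { isSemigroup = record
              { isMagma = record
                { isEquivalence = record { refl = ≈-refl ; sym = ≈-sym ; trans = ≈-trans }
                ; ∙-cong = +-cong }
              ; assoc = +-assoc }
            ; identity = +-identityˡ , +-identityʳ }
          ; inverse = -‿inverseˡ , -‿inverseʳ
          ; ⁻¹-cong = -‿cong }
        ; comm = +-comm }
      ; *-cong = *-cong
      ; *-assoc = *-assoc
      ; *-identity = *-identityˡ , *-identityʳ
      ; distrib = distribˡ , distribʳ
      }
    ; *-comm = *-comm
    }

  polynomialRing : CommutativeRing 0ℓ 0ℓ
  polynomialRing = record { isCommutativeRing = +-*-isCommutativeRing }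

------------------------------------------------------------------------
-- The ring 𝔹 M B T

module _ (M : Matroid n) (B : Subset n) where

  open Matroid M

  -- Membership proofs are irrelevant, so there is exactly one a x y for each
  -- matrix position and one i Z for each basis.
  data Indeterminate : Set where
    a : Elem B → Elem (∁ B) → Indeterminate
    i : [ Z ∈ Subset n ∣ Basis Z ] → Indeterminate

  _≟ᵢ_ : DecidableEquality Indeterminate
  a x y ≟ᵢ a x′ y′ = map′ (λ { (refl , refl) → refl }) (λ { refl → refl , refl })
    (Refinement._≟_ Fin._≟_ x x′ ×-dec Refinement._≟_ Fin._≟_ y y′)
  a _ _ ≟ᵢ i _     = no λ ()
  i _   ≟ᵢ a _ _   = no λ ()
  i Z   ≟ᵢ i Z′    = map′ (cong i) (λ { refl → refl })
    (Refinement._≟_ (Vec.≡-dec Bool._≟_) Z Z′)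

  open Polynomials _≟ᵢ_ using (polynomialRing; var)

  ℤ[𝒴] : CommutativeRing 0ℓ 0ℓ
  ℤ[𝒴] = polynomialRing

  private module P = CommutativeRing ℤ[𝒴]

  Â : Matrix P.rawRing B (∁ B)
  Â x y = var (a x y)

  module _ (T : BipartiteGraph B (∁ B) t) where

    -- The rank of M is ∣ B ∣, as B is a basis.
    data Generator : Pred P.Carrier t where
      nonbasis   : ∀ Z (eq : ∣ Z ∣ ≡ ∣ B ∣) → ¬ Basis Z →
                   Generator (basisMinor P.rawRing Â Z eq)
      basis      : ∀ Z (eq : ∣ Z ∣ ≡ ∣ B ∣) (Z∈ℬ : Basis Z) →
                   Generator (basisMinor P.rawRing Â Z eq P.* var (i (Z , [ Z∈ℬ ])) P.- P.1#)
      normalized : ∀ {x y} → T x y → Generator (Â x y P.- P.1#)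

    𝔹 : CommutativeRing 0ℓ t
    𝔹 = Quotient.quotientRing ℤ[𝒴] Generator

    Â[𝔹] : Matrix (CommutativeRing.rawRing 𝔹) B (∁ B)
    Â[𝔹] = Â

-- A ring homomorphism ℤ[V] → R is the evaluation at a map V → R.  Evaluate
-- a x y at A x y and i Z at the inverse of the minor of A belonging to the
-- basis Z.  Homomorphisms commute with determinants, so each generator of the
-- ideal is sent to the corresponding expression in the minors of A, which is 0
-- because M = M[I A] and A is T-normalized.
module Submission where

open import Algebra.Morphism.Structures using (IsRingHomomorphism)
open import Algebra.Bundles using (CommutativeRing; RawRing)
import Algebra.Definitions.RawMonoid as RawMonoidDefs
import Algebra.Definitions.RawSemiring as RawSemiringDefs
import Algebra.Properties.CommutativeSemigroup as CommutativeSemigroupProperties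
import Algebra.Properties.Monoid.Sum as SumProperties
import Algebra.Properties.Ring as RingProperties
import Algebra.Properties.Semiring.Exp as ExpProperties
import Algebra.Properties.Semiring.Mult as MultProperties
open import Data.Fin.Base using (Fin; punchIn; toℕ; zero; suc)
open import Data.Fin.Subset using (Subset; ∁; ∣_∣; _─_)
open import Data.Fin.Subset.Properties using (p─q⊆p; p∩q⊆p)
open import Data.Integer.Base as ℤ using (ℤ; 1ℤ; -[1+_]; _⊖_)
import Data.Integer.Properties as ℤ
open import Data.Irrelevant using ([_])
open import Data.List.Base using (List; []; _∷_; _++_; foldr; map)
open import Data.List.Relation.Binary.Permutation.Propositional using (_↭_; ↭⇒↭ₛ′)
open import Data.List.Relation.Binary.Permutation.Propositional.Properties using (map⁺)
import Data.List.Relation.Binary.Permutation.Setoid.Properties as PermutationProperties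
open import Data.Nat.Base as ℕ using (ℕ; zero; suc)
import Data.Nat.Properties as ℕ
open import Data.Product.Base using (Σ; ∃; _×_; _,_; proj₁; proj₂)
open import Data.Refinement using (_,_)
open import Data.Sum.Base using (inj₁; inj₂)
open import Function.Base using (_∘_)
open import Function.Bundles using (Equivalence)
open import Level using (Level)
open import Relation.Binary.Definitions using (DecidableEquality)
open import Relation.Binary.PropositionalEquality as ≡ using (_≡_)
open import Relation.Nullary using (¬_; contradiction)
open import Relation.Nullary.Decidable using (recompute)
open import Relation.Unary using (Pred)
open import Defs

private
  variable
    c ℓ c′ ℓ′ s : Level

-- Determinants and ring homomorphisms.

module _ (R : CommutativeRing c ℓ) where

  open CommutativeRing R hiding (zero)
  open SumProperties +-monoid using (sum-cong-≋)
  open ExpProperties semiring using (_^_)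

  det-cong : ∀ {k} {A B : Fin k → Fin k → Carrier} → (∀ i j → A i j ≈ B i j) →
             det rawRing {k} A ≈ det rawRing {k} B
  det-cong {zero}  e = refl
  det-cong {suc k} e = sum-cong-≋ λ j →
    *-congˡ {(- 1#) ^ toℕ j} (*-cong (e zero j) (det-cong {k} λ i l → e (suc i) (punchIn j l)))

module _ (K : RawRing c′ ℓ′) (R : CommutativeRing c ℓ) where

  private
    module K where
      open RawRing K public
      open RawMonoidDefs +-rawMonoid public using (sum)
      open RawSemiringDefs rawSemiring public using (_^_)

  open CommutativeRing R hiding (zero)
  open SumProperties +-monoid using (sum; sum-cong-≋)
  open ExpProperties semiring using (_^_; ^-congˡ)

  module _ {φ : K.Carrier → Carrier} (φ-hom : IsRingHomomorphism K rawRing φ) where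

    open IsRingHomomorphism φ-hom

    sum-homo : ∀ {k} (f : Fin k → K.Carrier) → φ (K.sum {k} f) ≈ sum {k} (φ ∘ f)
    sum-homo {zero}  f = 0#-homo
    sum-homo {suc k} f = trans (+-homo _ _) (+-congˡ (sum-homo (f ∘ suc)))

    ^-homo : ∀ x k → φ (x K.^ k) ≈ φ x ^ k
    ^-homo x zero    = 1#-homo
    ^-homo x (suc k) = trans (*-homo _ _) (*-congˡ (^-homo x k))

    -- Induction on the size: Laplace expansion is built from sums, products and powers of `- 1#`,
    -- all of which `φ` preserves.
    det-homo : ∀ {k} (A : Fin k → Fin k → K.Carrier) →
               φ (det K {k} A) ≈ det rawRing {k} (λ i j → φ (A i j))
    det-homo {zero}  A = 1#-homo
    det-homo {suc k} A = trans (sum-homo laplaceTerm) (sum-cong-≋ λ j →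
      trans (*-homo ((K.- K.1#) K.^ toℕ j) _) (*-cong
        (trans (^-homo (K.- K.1#) (toℕ j))
          (^-congˡ (toℕ j) (trans (-‿homo K.1#) (-‿cong 1#-homo))))
        (trans (*-homo (A zero j) _)
          (*-congˡ (det-homo λ i l → A (suc i) (punchIn j l))))))
      where
      laplaceTerm : Fin (suc k) → K.Carrier
      laplaceTerm j = (K.- K.1#) K.^ toℕ j K.* (A zero j K.* det K λ i l → A (suc i) (punchIn j l))

    -- The entries `φ (Â x y)` match those of `A` only up to `≈`, so `det-homo` is followed by
    -- `det-cong`.
    basisMinor-homo : ∀ {n} {X : Subset n} (Â : Matrix K X (∁ X)) {A : Matrix rawRing X (∁ X)} →
                      (∀ x y → φ (Â x y) ≈ A x y) →
                      ∀ Z eq → φ (basisMinor K Â Z eq) ≈ basisMinor rawRing A Z eq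
    basisMinor-homo {X = X} Â e Z eq =
      trans (det-homo {∣ X ─ Z ∣} _) (det-cong R {∣ X ─ Z ∣} λ i j → e _ _)

-- The canonical map from the integers.

module _ (R : CommutativeRing c ℓ) where

  open CommutativeRing R hiding (zero)
  open MultProperties semiring
    using (×-homo-+; ×1-homo-*; ×-homo-1) renaming (_×_ to _ℕ×_)
  open RingProperties ring
    using (-‿+-comm; -‿distribˡ-*; -‿involutive; -0#≈0#)
  open import Relation.Binary.Reasoning.Setoid setoid

  fromℤ : ℤ → Carrier
  fromℤ (ℤ.+ m)  = m ℕ× 1#
  fromℤ -[1+ m ] = - (suc m ℕ× 1#)

  fromℤ-1 : fromℤ 1ℤ ≈ 1#
  fromℤ-1 = ×-homo-1 1#

  fromℤ-neg : ∀ k → fromℤ (ℤ.- k) ≈ - fromℤ k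
  fromℤ-neg (ℤ.+ zero)  = sym -0#≈0#
  fromℤ-neg (ℤ.+ suc m) = refl
  fromℤ-neg -[1+ m ]    = sym (-‿involutive _)

  -- Sums of mixed sign compute to `⊖`. For two successors, the extra summands `1#` and `- 1#`
  -- cancel.
  fromℤ-⊖ : ∀ m n → fromℤ (m ⊖ n) ≈ m ℕ× 1# - n ℕ× 1#
  fromℤ-⊖ m       zero    = sym (trans (+-congˡ -0#≈0#) (+-identityʳ _))
  fromℤ-⊖ zero    (suc n) = sym (+-identityˡ _)
  fromℤ-⊖ (suc m) (suc n) = begin
    fromℤ (suc m ⊖ suc n)          ≡⟨ ≡.cong fromℤ (ℤ.[1+m]⊖[1+n]≡m⊖n m n) ⟩
    fromℤ (m ⊖ n)                  ≈⟨ fromℤ-⊖ m n ⟩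
    p - q                          ≈⟨ +-identityˡ _ ⟨
    0# + (p - q)                   ≈⟨ +-congʳ (-‿inverseʳ 1#) ⟨
    (1# - 1#) + (p - q)            ≈⟨ interchange 1# (- 1#) p (- q) ⟩
    (1# + p) + (- 1# - q)          ≈⟨ +-congˡ (-‿+-comm 1# q) ⟩
    (1# + p) - (1# + q)            ∎
    where
    p = m ℕ× 1#
    q = n ℕ× 1#
    open CommutativeSemigroupProperties +-commutativeSemigroup using (interchange)

  fromℤ-+ : ∀ k l → fromℤ (k ℤ.+ l) ≈ fromℤ k + fromℤ l
  fromℤ-+ (ℤ.+ m)  (ℤ.+ n)  = ×-homo-+ 1# m n
  fromℤ-+ (ℤ.+ m)  -[1+ n ] = fromℤ-⊖ m (suc n)
  fromℤ-+ -[1+ m ] (ℤ.+ n)  = trans (fromℤ-⊖ n (suc m)) (+-comm _ _)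
  fromℤ-+ -[1+ m ] -[1+ n ] = begin
    -- The sum computes to `-[1+ suc (m ℕ.+ n) ]`; moving one successor exposes `suc m ℕ.+ suc n`.
    - (suc (suc (m ℕ.+ n)) ℕ× 1#)        ≡⟨ ≡.cong (λ o → - (suc o ℕ× 1#)) (ℕ.+-suc m n) ⟨
    - ((suc m ℕ.+ suc n) ℕ× 1#)          ≈⟨ -‿cong (×-homo-+ 1# (suc m) (suc n)) ⟩
    - (suc m ℕ× 1# + suc n ℕ× 1#)        ≈⟨ -‿+-comm _ _ ⟨
    - (suc m ℕ× 1#) - suc n ℕ× 1#        ∎

  private
    -- Carries multiplicativity from `k` to `ℤ.- k`, which reduces every product to nonnegative
    -- factors.
    fromℤ-neg-* : ∀ k l → fromℤ (k ℤ.* l) ≈ fromℤ k * fromℤ l →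
                  fromℤ (ℤ.- k ℤ.* l) ≈ fromℤ (ℤ.- k) * fromℤ l
    fromℤ-neg-* k l e = begin
      fromℤ (ℤ.- k ℤ.* l)        ≡⟨ ≡.cong fromℤ (ℤ.neg-distribˡ-* k l) ⟨
      fromℤ (ℤ.- (k ℤ.* l))      ≈⟨ fromℤ-neg (k ℤ.* l) ⟩
      - fromℤ (k ℤ.* l)          ≈⟨ -‿cong e ⟩
      - (fromℤ k * fromℤ l)      ≈⟨ -‿distribˡ-* _ _ ⟩
      - fromℤ k * fromℤ l        ≈⟨ *-congʳ (fromℤ-neg k) ⟨
      fromℤ (ℤ.- k) * fromℤ l    ∎

    fromℤ-+ve-* : ∀ m l → fromℤ (ℤ.+ m ℤ.* l) ≈ fromℤ (ℤ.+ m) * fromℤ l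
    fromℤ-+ve-* m (ℤ.+ n)  = trans
      (reflexive (≡.cong fromℤ (≡.sym (ℤ.pos-* m n)))) (×1-homo-* m n)
    fromℤ-+ve-* m -[1+ n ] = begin
      -- With the negative factor in front, the recursive call has two nonnegative factors and falls
      -- under the first clause.
      fromℤ (ℤ.+ m ℤ.* -[1+ n ])        ≡⟨ ≡.cong fromℤ (ℤ.*-comm (ℤ.+ m) -[1+ n ]) ⟩
      fromℤ (-[1+ n ] ℤ.* ℤ.+ m)        ≈⟨ fromℤ-neg-* (ℤ.+ suc n) (ℤ.+ m) (fromℤ-+ve-* (suc n) (ℤ.+ m)) ⟩
      fromℤ -[1+ n ] * fromℤ (ℤ.+ m)    ≈⟨ *-comm _ _ ⟩
      fromℤ (ℤ.+ m) * fromℤ -[1+ n ]    ∎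

  fromℤ-* : ∀ k l → fromℤ (k ℤ.* l) ≈ fromℤ k * fromℤ l
  fromℤ-* (ℤ.+ m)  l = fromℤ-+ve-* m l
  fromℤ-* -[1+ m ] l = fromℤ-neg-* (ℤ.+ suc m) l (fromℤ-+ve-* (suc m) l)

-- Evaluation of integer polynomials at a point.

module Evaluation (R : CommutativeRing c ℓ) {V : Set} (_≟_ : DecidableEquality V)
                  (ν : V → CommutativeRing.Carrier R) where

  open CommutativeRing R hiding (zero)
  open CommutativeSemigroupProperties *-commutativeSemigroup using (interchange)
  open PermutationProperties setoid using (foldr-commMonoid)
  private module P = Polynomials _≟_
  open P using (Monomial; Polynomial; extend-cong)
  open P.Extend +-abelianGroup
  open import Relation.Binary.Reasoning.Setoid setoid

  evalMonomial : Monomial → Carrier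
  evalMonomial m = foldr _*_ 1# (map ν m)

  evalMonomial-↭ : ∀ {m m′} → m ↭ m′ → evalMonomial m ≈ evalMonomial m′
  evalMonomial-↭ p = foldr-commMonoid *-isCommutativeMonoid (↭⇒↭ₛ′ isEquivalence (map⁺ ν p))

  evalMonomial-++ : ∀ m m′ → evalMonomial (m ++ m′) ≈ evalMonomial m * evalMonomial m′
  evalMonomial-++ []      m′ = sym (*-identityˡ _)
  evalMonomial-++ (v ∷ m) m′ = trans (*-congˡ (evalMonomial-++ m m′)) (sym (*-assoc _ _ _))

  evalTerm : ℤ → Monomial → Carrier
  evalTerm k m = fromℤ R k * evalMonomial m

  -- This makes `eval` well defined: formal sums are equal when their coefficients agree, and
  -- monomials count up to reordering.
  evalTerm-isAdditive : IsAdditive evalTerm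
  evalTerm-isAdditive = record
    { resp-↭ = λ k p → *-congˡ (evalMonomial-↭ p)
    ; homo-+ = λ k l m → trans (*-congʳ (fromℤ-+ R k l)) (distribʳ _ _ _)
    }

  evalTerm-* : ∀ k l m m′ → evalTerm (k ℤ.* l) (m ++ m′) ≈ evalTerm k m * evalTerm l m′
  evalTerm-* k l m m′ =
    trans (*-cong (fromℤ-* R k l) (evalMonomial-++ m m′)) (interchange _ _ _ _)

  eval : Polynomial → Carrier
  eval = extend evalTerm

  eval-var : ∀ v → eval (P.var v) ≈ ν v
  eval-var v = begin
    fromℤ R 1ℤ * (ν v * 1#) + 0#    ≈⟨ +-identityʳ _ ⟩
    fromℤ R 1ℤ * (ν v * 1#)         ≈⟨ *-cong (fromℤ-1 R) (*-identityʳ _) ⟩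
    1# * ν v                        ≈⟨ *-identityˡ _ ⟩
    ν v                             ∎

  extend-*ˡ : ∀ x f p → extend (λ k m → x * f k m) p ≈ x * extend f p
  extend-*ˡ x f []            = sym (zeroʳ x)
  extend-*ˡ x f ((k , m) ∷ p) = trans (+-congˡ (extend-*ˡ x f p)) (sym (distribˡ _ _ _))

  extend-*ʳ : ∀ x f p → extend (λ k m → f k m * x) p ≈ extend f p * x
  extend-*ʳ x f p = trans (extend-≗ (λ k m → *-comm _ _) p)
    (trans (extend-*ˡ x f p) (*-comm _ _))

  -- The product is a double sum over pairs of terms. Each summand factors by `evalTerm-*`, and the
  -- constant factor is pulled out of the inner, then of the outer sum.
  eval-* : ∀ p q → eval (p P.* q) ≈ eval p * eval q
  eval-* p q = begin
    eval (p P.* q)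
      ≈⟨ extend-* evalTerm p q ⟩
    extend (λ k m → extend (λ l m′ → evalTerm (k ℤ.* l) (m ++ m′)) q) p
      ≈⟨ extend-≗ (λ k m → trans
           (extend-≗ (λ l m′ → evalTerm-* k l m m′) q) (extend-*ˡ _ evalTerm q)) p ⟩
    extend (λ k m → evalTerm k m * eval q) p
      ≈⟨ extend-*ʳ _ evalTerm p ⟩
    eval p * eval q ∎

  eval-isRingHomomorphism :
    IsRingHomomorphism (CommutativeRing.rawRing P.polynomialRing) rawRing eval
  eval-isRingHomomorphism = record
    { isSemiringHomomorphism = record
      { isNearSemiringHomomorphism = record
        { +-isMonoidHomomorphism = record
          { isMagmaHomomorphism = record
            { isRelHomomorphism = record
              { cong = extend-cong +-abelianGroup evalTerm-isAdditive }
            ; homo = extend-++ evalTerm }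
          ; ε-homo = refl }
        ; *-homo = eval-* }
      ; 1#-homo = trans (+-identityʳ _) (trans (*-identityʳ _) (fromℤ-1 R)) }
    ; -‿homo = extend-neg evalTerm-isAdditive
    }

-- Homomorphisms out of a quotient ring.

module _ (R : CommutativeRing c ℓ) (S : Pred (CommutativeRing.Carrier R) s)
         (R′ : CommutativeRing c′ ℓ′) where

  private module R = CommutativeRing R
  open CommutativeRing R′
  open RingProperties ring using (x∙y⁻¹≈ε⇒x≈y)
  open Quotient R S

  module _ {φ : R.Carrier → Carrier} (φ-hom : IsRingHomomorphism R.rawRing rawRing φ)
           (φ-generator : ∀ {x} → S x → φ x ≈ 0#) where

    open IsRingHomomorphism φ-hom

    ideal⊆kernel : ∀ {x} → Ideal x → φ x ≈ 0#
    ideal⊆kernel (generator g) = φ-generator g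
    ideal⊆kernel 0∈            = 0#-homo
    ideal⊆kernel (+∈ p q)      = trans (+-homo _ _)
      (trans (+-cong (ideal⊆kernel p) (ideal⊆kernel q)) (+-identityˡ 0#))
    ideal⊆kernel (*∈ r p)      = trans (*-homo _ _)
      (trans (*-congˡ (ideal⊆kernel p)) (zeroʳ _))
    ideal⊆kernel (resp e p)    = trans (⟦⟧-cong (R.sym e)) (ideal⊆kernel p)

    -- The quotient keeps carrier and operations and only coarsens equality, so `cong` alone has
    -- content: if `x - y` is in the ideal, then `φ x - φ y` vanishes.
    quotient-isRingHomomorphism :
      IsRingHomomorphism (CommutativeRing.rawRing quotientRing) rawRing φ
    quotient-isRingHomomorphism = record
      { isSemiringHomomorphism = record
        { isNearSemiringHomomorphism = record
          { +-isMonoidHomomorphism = record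
            { isMagmaHomomorphism = record
              { isRelHomomorphism = record
                { cong = λ {x} {y} (mk p) → x∙y⁻¹≈ε⇒x≈y _ _
                    (trans (sym (trans (+-homo x (R.- y)) (+-congˡ (-‿homo y)))) (ideal⊆kernel p)) }
              ; homo = +-homo }
            ; ε-homo = 0#-homo }
          ; *-homo = *-homo }
        ; 1#-homo = 1#-homo }
      ; -‿homo = -‿homo
      }

-- The homomorphism determined by `A`.

lemma4p11 : {c ℓ g t : Level} {n : ℕ} (ℙ : PartialField c ℓ g) (let module R = PartialField ℙ)
    (M : Matroid n) (B : Subset n) → Matroid.Basis M B →
    (A : Matrix R.rawRing B (∁ B)) → IsPMatrix ℙ A → _≐M[I_] R.rawRing M A →
    (T : BipartiteGraph B (∁ B) t) → IsMaximalSpanningForest (supportGraph R.rawRing A) T →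
    Normalized R.rawRing A T →
    Σ (CommutativeRing.Carrier (𝔹 M B T) → R.Carrier) λ φ →
    IsRingHomomorphism (CommutativeRing.rawRing (𝔹 M B T)) R.rawRing φ ×
    (∀ x y → φ (Â[𝔹] M B T x y) R.≈ A x y)
lemma4p11 ℙ M B B∈ℬ A A-ℙ M≐ T _ A-normalized =
  eval , quotient-isRingHomomorphism (ℤ[𝒴] M B) (Generator M B T) commutativeRing
           eval-isRingHomomorphism generator-vanishes , λ x y → eval-var (a x y)
  where
  open PartialField ℙ
  open Matroid M using (Basis; Basis?)
  open RingProperties ring using (x≈y⇒x∙y⁻¹≈ε)
  module M≐ Z = Equivalence (M≐ Z)

  minorA : ∀ Z → ∣ Z ∣ ≡ ∣ B ∣ → Carrier
  minorA = basisMinor rawRing A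

  minorA-element : ∀ Z eq → Element (minorA Z eq)
  minorA-element Z eq = IsPMatrix.minors A-ℙ _ _ (p─q⊆p B Z) (p∩q⊆p (∁ B) Z) (∣X─Z∣≡∣∁X∩Z∣ B Z eq)

  -- In the zero ring M[I A] would have no bases at all.
  1≉0 : ¬ (1# ≈ 0#)
  1≉0 1≈0 with eq , minor≉0 ← M≐.to B B∈ℬ =
    minor≉0 (trans (sym (*-identityʳ _)) (trans (*-congˡ 1≈0) (zeroʳ _)))

  -- Links membership in `G` to the nonvanishing by which `M[I A]` recognises bases.
  G⇒≉0 : ∀ {x} → G x → ¬ (x ≈ 0#)
  G⇒≉0 x∈G x≈0 with y , _ , xy≈1 ← inverse x∈G =
    1≉0 (trans (sym xy≈1) (trans (*-congʳ x≈0) (zeroˡ y)))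

  -- As `A` is a ℙ-matrix, the minor lies in `G` or is zero, so `≈` need not be decided; in `G` it
  -- would make `Z` a basis.
  minorA-nonbasis : ∀ Z eq → ¬ Basis Z → minorA Z eq ≈ 0#
  minorA-nonbasis Z eq Z∉ℬ with minorA-element Z eq
  ... | inj₁ ∈G  = contradiction (M≐.from Z (eq , G⇒≉0 ∈G)) Z∉ℬ
  ... | inj₂ ≈0  = ≈0

  -- The inverse is chosen ahead of `eq`: the indeterminate of `Z` carries no cardinality proof,
  -- while a generator may use any.
  minorA-invertible : ∀ Z → Basis Z → ∃ λ y → ∀ eq → minorA Z eq * y ≈ 1#
  minorA-invertible Z Z∈ℬ with eq , minor≉0 ← M≐.to Z Z∈ℬ with minorA-element Z eq
  ... | inj₂ ≈0 = contradiction ≈0 minor≉0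
  ... | inj₁ ∈G with y , _ , xy≈1 ← inverse ∈G =
    -- Equality proofs in `ℕ` are unique, so the inverse found for `eq` also serves `eq′`.
    y , λ eq′ → ≡.subst (λ e → minorA Z e * y ≈ 1#) (ℕ.≡-irrelevant eq eq′) xy≈1

  ν : Indeterminate M B → Carrier
  ν (a x y)         = A x y
  -- The proof `p` is irrelevant; decidability of `Basis` yields a usable one.
  ν (i (Z , [ p ])) = proj₁ (minorA-invertible Z (recompute (Basis? Z) p))

  open Evaluation commutativeRing (_≟ᵢ_ M B) ν
  open IsRingHomomorphism eval-isRingHomomorphism
  open Polynomials (_≟ᵢ_ M B) using (var)
  module P = CommutativeRing (ℤ[𝒴] M B)

  eval-minor : ∀ Z eq → eval (basisMinor P.rawRing (Â M B) Z eq) ≈ minorA Z eq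
  eval-minor = basisMinor-homo P.rawRing commutativeRing eval-isRingHomomorphism (Â M B)
    λ x y → eval-var (a x y)

  -- The `basis` and `normalized` generators both have this shape.
  eval-vanishes : ∀ p → eval p ≈ 1# → eval (p P.- P.1#) ≈ 0#
  eval-vanishes p e = trans (+-homo p (P.- P.1#))
    (trans (+-congˡ (-‿homo P.1#)) (x≈y⇒x∙y⁻¹≈ε (trans e (sym 1#-homo))))

  generator-vanishes : ∀ {p} → Generator M B T p → eval p ≈ 0#
  generator-vanishes (nonbasis Z eq Z∉ℬ) =
    trans (eval-minor Z eq) (minorA-nonbasis Z eq Z∉ℬ)
  generator-vanishes (basis Z eq Z∈ℬ) = eval-vanishes (m P.* var Z⁻¹)
    (trans (*-homo m (var Z⁻¹)) (trans (*-cong (eval-minor Z eq) (eval-var Z⁻¹))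
      -- The placeholder is the recomputed proof from `ν`, so the inverse here is exactly `ν Z⁻¹`.
      (proj₂ (minorA-invertible Z _) eq)))
    where
    m   = basisMinor P.rawRing (Â M B) Z eq
    Z⁻¹ = i (Z , [ Z∈ℬ ])
  generator-vanishes (normalized {x} {y} xy∈T) =
    eval-vanishes (Â M B x y) (trans (eval-var (a x y)) (A-normalized xy∈T))
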